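{- If $G$ is a tightly closed graph on $[n]$, then $NC_G$ is graded.
   Context: Graphs are finite simple graphs with vertex set $[n]$; edges are written $ij$ with $i<j$. Two edges $a_1a_2$ and $b_1b_2$ cross if $a_1<b_1<a_2<b_2$ or $b_1<a_1<b_2<a_2$. A bond of $G$ is a spanning subgraph (identified with its edge set) each of whose connected components is an induced subgraph of $G$; it is noncrossing if there are no two distinct components with vertex sets $B,B'$ and $a,c\in B$, $b,d\in B'$, $a<b<c<d$. $NC_G$ is the poset of noncrossing bonds ordered by inclusion of edge sets. Two crossing edges $e,f$ are crossing closed if among all induced connected subgraphs of $G$ containing $e$ and $f$ there is a unique minimal one under containment, denoted $J(e,f)$; $G$ is crossing closed if all pairs of crossing edges are. $G$ is tightly closed if it is crossing closed and for all crossing edges $e,f$, $J(e,f)$ is a subgraph of $K_4$. -}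

module Defs where

open import Level using (Level; 0ℓ; _⊔_)
open import Data.Bool.Base using (Bool; T)
open import Data.Nat.Base using (ℕ)
open import Data.Fin.Base using (Fin; _<_)
open import Data.Fin.Properties using (_≟_)
open import Data.Fin.Subset using (Subset; _∈_; _⊆_)
open import Data.List.Base using (List; length)
open import Data.List.Relation.Unary.Linked using (Linked)
import Data.List.Relation.Binary.Subset.Setoid as ListSubset
open import Data.Product using (Σ; _×_; _,_; proj₁; proj₂; ∃; ∃!; swap)
open import Data.Sum.Base using (_⊎_)
open import Function.Base using (id; _∘_)
open import Relation.Binary.Bundles using (Poset)
open import Relation.Binary.Core using (Rel; _⇒_; _⇔_)
open import Relation.Binary.Construct.Closure.ReflexiveTransitive using (Star)
open import Relation.Binary.PropositionalEquality.Core using (_≡_; refl; sym)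
import Relation.Binary.Properties.Poset as PosetProperties
open import Relation.Nullary.Decidable using (isYes; ¬?; toWitness; fromWitness)
open import Relation.Nullary.Negation using (¬_)
open import Relation.Unary using (Pred; _≐_)

-- Finite simple graphs, with vertex set Fin n in place of [n].
record Graph (n : ℕ) : Set where
  field
    adj        : Fin n → Fin n → Bool
    adj-sym    : ∀ {i j} → T (adj i j) → T (adj j i)
    adj-irrefl : ∀ {i} → ¬ T (adj i i)

Adj : ∀ {n} → Graph n → Rel (Fin n) 0ℓ
Adj G i j = T (Graph.adj G i j)

complete : ∀ m → Graph m
complete m = record
  { adj        = λ i j → isYes (¬? (i ≟ j))
  ; adj-sym    = λ i≁j → fromWitness (toWitness i≁j ∘ sym)
  ; adj-irrefl = λ i≁i → toWitness i≁i refl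
  }

record Edge {n} (G : Graph n) : Set where
  field
    lo hi : Fin n
    lo<hi : lo < hi
    lo~hi : Adj G lo hi

open Edge

Crossing : ∀ {n} {G : Graph n} → Edge G → Edge G → Set
Crossing e f = (lo e < lo f × lo f < hi e × hi e < hi f)
             ⊎ (lo f < lo e × lo e < hi f × hi f < hi e)

-- An induced subgraph of G is represented by its vertex set S; containment of
-- induced subgraphs is then inclusion of vertex sets.
InducedAdj : ∀ {n} → Graph n → Subset n → Rel (Fin n) 0ℓ
InducedAdj G S i j = i ∈ S × j ∈ S × Adj G i j

InducedConnected : ∀ {n} → Graph n → Subset n → Set
InducedConnected G S = ∀ {i j} → i ∈ S → j ∈ S → Star (InducedAdj G S) i j

Contains : ∀ {n} {G : Graph n} → Subset n → Edge G → Set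
Contains S e = lo e ∈ S × hi e ∈ S

Connecting : ∀ {n} {G : Graph n} → Edge G → Edge G → Pred (Subset n) 0ℓ
Connecting {G = G} e f S = InducedConnected G S × Contains S e × Contains S f

Minimal : ∀ {n} → Pred (Subset n) 0ℓ → Pred (Subset n) 0ℓ
Minimal P S = P S × (∀ {S′} → P S′ → S′ ⊆ S → S′ ≡ S)

CrossingClosedPair : ∀ {n} {G : Graph n} → Edge G → Edge G → Set
CrossingClosedPair e f = ∃! _≡_ (Minimal (Connecting e f))

CrossingClosed : ∀ {n} → Graph n → Set
CrossingClosed G = (e f : Edge G) → Crossing e f → CrossingClosedPair e f

J : ∀ {n} {G : Graph n} (e f : Edge G) → CrossingClosedPair e f → Subset n
J _ _ = proj₁

-- The subgraph of G induced by S is, up to isomorphism, a subgraph of K.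
-- The values of the embedding outside S are irrelevant.
InducedSubgraphOf : ∀ {n m} → Graph n → Subset n → Graph m → Set
InducedSubgraphOf {n} {m} G S K = ∃ λ (φ : Fin n → Fin m) →
  (∀ {i j} → i ∈ S → j ∈ S → φ i ≡ φ j → i ≡ j) ×
  (∀ {i j} → InducedAdj G S i j → Adj K (φ i) (φ j))

TightlyClosed : ∀ {n} → Graph n → Set
TightlyClosed G = Σ (CrossingClosed G) λ closed →
  ∀ e f (x : Crossing e f) → InducedSubgraphOf G (J e f (closed e f x)) (complete 4)

-- Vertex set of the connected component of v.
Component : ∀ {n} → Graph n → Fin n → Pred (Fin n) 0ℓ
Component H v w = Star (Adj H) v w

IsBond : ∀ {n} → Graph n → Graph n → Set
IsBond G H = (Adj H ⇒ Adj G) ×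
  (∀ v {i j} → Component H v i → Component H v j → Adj G i j → Adj H i j)

IsNoncrossing : ∀ {n} → Graph n → Set
IsNoncrossing H = ∀ u v → ¬ (Component H u ≐ Component H v) →
  ∀ {a b c d} → Component H u a → Component H u c →
                Component H v b → Component H v d →
                ¬ (a < b × b < c × c < d)

record NoncrossingBond {n} (G : Graph n) : Set where
  field
    graph       : Graph n
    isBond      : IsBond G graph
    noncrossing : IsNoncrossing graph

open NoncrossingBond

NC : ∀ {n} → Graph n → Poset 0ℓ 0ℓ 0ℓ
NC G = record
  { Carrier = NoncrossingBond G
  ; _≈_     = λ A B → Adj (graph A) ⇔ Adj (graph B)
  ; _≤_     = λ A B → Adj (graph A) ⇒ Adj (graph B)
  ; isPartialOrder = record
    { isPreorder = record
      { isEquivalence = record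
        { refl  = id , id
        ; sym   = swap
        ; trans = λ (p , p′) (q , q′) → q ∘ p , p′ ∘ q′
        }
      ; reflexive = proj₁
      ; trans     = λ p q → q ∘ p
      }
    ; antisym = _,_
    }
  }

-- Chains are given as strictly increasing lists, so only finite chains are
-- considered; in a finite poset these are all the chains.
module _ {c ℓ₁ ℓ₂ : Level} (P : Poset c ℓ₁ ℓ₂) where
  open Poset P using (Carrier; module Eq)
  open PosetProperties P using () renaming (_<_ to _⊏_)
  open ListSubset Eq.setoid using () renaming (_⊆_ to _⊑_)

  IsChain : Pred (List Carrier) (c ⊔ ℓ₁ ⊔ ℓ₂)
  IsChain = Linked _⊏_

  IsMaximalChain : Pred (List Carrier) (c ⊔ ℓ₁ ⊔ ℓ₂)
  IsMaximalChain xs = IsChain xs × (∀ {ys} → IsChain ys → xs ⊑ ys → ys ⊑ xs)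

  -- All maximal chains have the same length.
  Graded : Set (c ⊔ ℓ₁ ⊔ ℓ₂)
  Graded = ∀ {xs ys} → IsMaximalChain xs → IsMaximalChain ys →
           length xs ≡ length ys

-- Tightness means that two crossing edges are always joined by an edge of G, since J(e,f)
-- can contain no vertices besides the four endpoints. Hence G itself is noncrossing, and it
-- suffices that for noncrossing bonds A < B one can merge two components of A inside B into
-- a noncrossing bond C ≤ B; the number of components then grades NC_G. Among the edges ab
-- of B between different components of A, choose one with as few components of A separating
-- a from b as possible. If some component D separates them, an edge pq of D crosses ab, so
-- some edge joins {a,b} to {p,q}; it lies in B, and by planarity every component separating
-- its ends also separates a from b, while D no longer does. So no component separates a
-- from b, and merging the components of a and b creates no crossing.

module Submission where

open import Level using (0ℓ)
open import Data.Empty using (⊥-elim)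
open import Data.Bool.Base using (Bool; true; false; not; if_then_else_; _xor_)
open import Data.Bool.Properties using (xor-comm; xor-same; not-involutive) renaming (_≟_ to _≟ᵇ_)
import Data.Nat.Base as ℕ
import Data.Nat.Properties as ℕ
open import Data.Nat.Base using (ℕ; zero; suc; _+_)
open import Data.Nat.Properties using (+-suc; +-identityʳ; +-cancelˡ-≡; 1+n≰n; 1+n≢n)
open import Data.Fin.Base using (Fin; zero; suc; toℕ; _<_)
open import Data.Fin.Properties
  using (_≟_; _<?_; <-cmp; <-trans; <-irrefl; <-asym; any?; injective⇒≤)
open import Data.Fin.Induction using (<-wellFounded)
open import Data.Fin.Subset using (Subset; inside; outside; _∈_; _∉_; _⊆_; _⊂_; _∪_; ⁅_⁆; ∣_∣)
open import Data.Fin.Subset.Induction using (⊂-wellFounded)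
open import Data.Fin.Subset.Properties
  using (⊆-antisym; ∪-identityʳ; x∈p∪q⁺; x∈p∪q⁻; x∈⁅x⁆; x∈⁅y⁆⇒x≡y)
open import Data.List.Base using (List; []; _∷_; length; allFin)
open import Data.List.Membership.Propositional using () renaming (_∈_ to _∈ˡ_)
open import Data.List.Membership.Propositional.Properties using (∈-allFin)
open import Data.List.Relation.Unary.Any using (here; there)
open import Data.List.Relation.Unary.Linked using ([]; [-]; _∷_)
open import Data.Product using (_×_; _,_; proj₁; proj₂; ∃; ∃₂)
open import Data.Sum.Base using (_⊎_; inj₁; inj₂) renaming (swap to swap⊎)
open import Data.Vec.Base using (tabulate; lookup; here; there; []; _∷_)
open import Data.Vec.Properties using (lookup∘tabulate; []=⇒lookup; lookup⇒[]=)
open import Data.Vec.Relation.Unary.All using ([]; _∷_)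
open import Data.Vec.Relation.Unary.All.Properties using () renaming (lookup⁺ to lookupAll)
open import Data.Vec.Relation.Unary.AllPairs using ([]; _∷_)
open import Data.Vec.Relation.Unary.Unique.Propositional using (Unique)
open import Data.Vec.Relation.Unary.Unique.Propositional.Properties using (lookup-injective)
open import Function.Base using (id; _∘_; case_of_)
open import Induction.WellFounded using (Acc; acc)
open import Relation.Binary.Bundles using (Poset)
open import Relation.Binary.Core using (Rel)
open import Relation.Binary.Definitions using (Decidable; tri<; tri≈; tri>)
open import Relation.Binary.Structures using (IsEquivalence)
open import Relation.Binary.Construct.Closure.ReflexiveTransitive
  using (Star; ε; _◅_; _◅◅_; return; reverse) renaming (map to mapStar)
import Relation.Binary.Properties.Poset as PosetProperties
open import Relation.Binary.PropositionalEquality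
  using (_≡_; _≢_; refl; sym; trans; cong; cong₂; ≢-sym)
open import Relation.Nullary.Decidable
  using (Dec; yes; no; does; isYes; T?; ¬?; _×-dec_; _⊎-dec_; map′; toWitness; fromWitness;
         dec-true; dec-false; decidable-stable)
open import Relation.Nullary.Negation using (¬_; contradiction)
import Relation.Unary as U

open import Defs

open NoncrossingBond

-- Posets graded by a rank

module _ {c ℓ₁ ℓ₂} (P : Poset c ℓ₁ ℓ₂) where
  open Poset P using (Carrier; _≈_; _≤_; reflexive; antisym; module Eq) renaming (trans to ≤-trans)
  open PosetProperties P using () renaming (_<_ to _⊏_)
  open import Data.List.Relation.Binary.Subset.Setoid Eq.setoid using () renaming (_⊆_ to _⊑_)
  open import Data.List.Membership.Setoid Eq.setoid using () renaming (_∈_ to _∈ᴾ_)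

  head-least : ∀ {x xs w} → IsChain P (x ∷ xs) → w ∈ᴾ (x ∷ xs) → x ≤ w
  head-least _             (here w≈x) = reflexive (Eq.sym w≈x)
  head-least (x⊏y ∷ chain) (there w∈) = ≤-trans (proj₁ x⊏y) (head-least chain w∈)

  private
    MaximalFrom : Carrier → List Carrier → Set _
    MaximalFrom x xs = ∀ {ys} → IsChain P (x ∷ ys) → (x ∷ xs) ⊑ (x ∷ ys) → (x ∷ ys) ⊑ (x ∷ xs)

    -- A chain from `y` that refines the tail competes with the whole chain once `x` is put in
    -- front. Its elements lie above `y`, so none of them is `x`.
    maximal-tail : ∀ {x y xs} → x ⊏ y → MaximalFrom x (y ∷ xs) → MaximalFrom y xs
    maximal-tail {x} {y} {xs} (x≤y , x≉y) maximal {ys} chain ⊑ys {w} w∈ =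
      case maximal ((x≤y , x≉y) ∷ chain) extend (there w∈) of λ where
        (here w≈x)  → contradiction
          (antisym x≤y (≤-trans (head-least chain w∈) (reflexive w≈x))) x≉y
        (there w∈′) → w∈′
      where
      extend : (x ∷ y ∷ xs) ⊑ (x ∷ y ∷ ys)
      extend (here v≈x) = here v≈x
      extend (there v∈) = there (⊑ys v∈)

    insert-second : ∀ {x z xs} → (x ∷ xs) ⊑ (x ∷ z ∷ xs)
    insert-second (here v≈x) = here v≈x
    insert-second (there v∈) = there (there v∈)

  -- In a maximal chain the interpolant of two consecutive elements must be the upper one, so `rank`
  -- rises by exactly one at each step. Such a chain runs from `bot` to `top`, whose ranks therefore
  -- determine its length.
  graded : Decidable _≈_ → (rank : Carrier → ℕ) → (∀ {x y} → x ≈ y → rank x ≡ rank y) →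
           (bot top : Carrier) → (∀ x → bot ≤ x) → (∀ x → x ≤ top) →
           (∀ {x y} → x ⊏ y → ∃ λ z → x ⊏ z × z ≤ y × rank z ≡ suc (rank x)) →
           Graded P
  graded _≈?_ rank rank-cong bot top bot≤ ≤top interpolate max-xs max-ys =
    let k , xs-length , xs-rank = length-maximal _ max-xs
        l , ys-length , ys-rank = length-maximal _ max-ys
    in trans xs-length (trans
         (cong suc (+-cancelˡ-≡ (rank bot) k l (trans xs-rank (sym ys-rank)))) (sym ys-length))
    where
    length-from : ∀ {x} xs → IsChain P (x ∷ xs) → MaximalFrom x xs → rank x + length xs ≡ rank top
    length-from {x} [] _ maximal with x ≈? top
    ... | yes x≈top = trans (+-identityʳ _) (rank-cong x≈top)
    ... | no x≉top with maximal ((≤top x , x≉top) ∷ [-]) insert-second (there (here Eq.refl))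
    ...   | here top≈x = contradiction (Eq.sym top≈x) x≉top
    length-from {x} (y ∷ xs) (x⊏y ∷ chain) maximal with interpolate x⊏y
    ... | z , x⊏z , z≤y , rank-z with z ≈? y
    ...   | yes z≈y = trans (+-suc _ _) (trans
              (cong (_+ length xs) (trans (sym rank-z) (rank-cong z≈y)))
              (length-from xs chain (maximal-tail x⊏y maximal)))
    ...   | no z≉y with maximal (x⊏z ∷ (z≤y , z≉y) ∷ chain) insert-second (there (here Eq.refl))
    ...     | here z≈x = contradiction (Eq.sym z≈x) (proj₂ x⊏z)
    ...     | there z∈ = contradiction (antisym z≤y (head-least chain z∈)) z≉y

    -- The number `k` counts the steps of the chain, one fewer than its elements. A chain without
    -- `bot` could be extended by it.
    length-maximal : ∀ xs → IsMaximalChain P xs →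
                     ∃ λ k → length xs ≡ suc k × rank bot + k ≡ rank top
    length-maximal [] (_ , maximal) with () ← maximal {bot ∷ []} [-] (λ ()) (here Eq.refl)
    length-maximal (x ∷ xs) (chain , maximal) with bot ≈? x
    ... | yes bot≈x = length xs , refl ,
            trans (cong (_+ length xs) (rank-cong bot≈x)) (length-from xs chain maximal)
    ... | no bot≉x = contradiction
            (antisym (bot≤ x)
              (head-least chain (maximal ((bot≤ x , bot≉x) ∷ chain) there (here Eq.refl))))
            bot≉x

-- Reachability and counting in Fin n

module _ {n} {R : Rel (Fin n) 0ℓ} where

  private
    -- Warshall's algorithm: all interior vertices of the path lie in the list.
    Through : List (Fin n) → Rel (Fin n) 0ℓ
    Through []       i j = i ≡ j ⊎ R i j
    Through (k ∷ ks) i j = Through ks i j ⊎ (Through ks i k × Through ks k j)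

    through? : Decidable R → ∀ ks → Decidable (Through ks)
    through? R? []       i j = i ≟ j ⊎-dec R? i j
    through? R? (k ∷ ks) i j = through? R? ks i j ⊎-dec (through? R? ks i k ×-dec through? R? ks k j)

    through⇒star : ∀ ks {i j} → Through ks i j → Star R i j
    through⇒star []       (inj₁ refl)      = ε
    through⇒star []       (inj₂ r)         = return r
    through⇒star (k ∷ ks) (inj₁ p)         = through⇒star ks p
    through⇒star (k ∷ ks) (inj₂ (p , q)) = through⇒star ks p ◅◅ through⇒star ks q

    direct : ∀ ks {i j} → i ≡ j ⊎ R i j → Through ks i j
    direct []       r = r
    direct (k ∷ ks) r = inj₁ (direct ks r)

    -- When `k` heads the list, loops at `k` are cut off. Otherwise, if both paths visit the head,
    -- the detour between the two visits is dropped, and `k` with it.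
    through-via : ∀ {k ks i j} → k ∈ˡ ks → Through ks i k → Through ks k j → Through ks i j
    through-via (here refl) (inj₁ p)       (inj₁ q)       = inj₂ (p , q)
    through-via (here refl) (inj₁ p)       (inj₂ (_ , q)) = inj₂ (p , q)
    through-via (here refl) (inj₂ (p , _)) (inj₁ q)       = inj₂ (p , q)
    through-via (here refl) (inj₂ (p , _)) (inj₂ (_ , q)) = inj₂ (p , q)
    through-via (there k∈) (inj₁ p)        (inj₁ q)        = inj₁ (through-via k∈ p q)
    through-via (there k∈) (inj₁ p)        (inj₂ (q , q′)) = inj₂ (through-via k∈ p q , q′)
    through-via (there k∈) (inj₂ (p , p′)) (inj₁ q)        = inj₂ (p , through-via k∈ p′ q)
    through-via (there k∈) (inj₂ (p , _))  (inj₂ (_ , q))  = inj₂ (p , q)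

    star⇒through : ∀ {i j} → Star R i j → Through (allFin n) i j
    star⇒through ε        = direct (allFin n) (inj₁ refl)
    star⇒through (r ◅ rs) =
      through-via (∈-allFin _) (direct (allFin n) (inj₂ r)) (star⇒through rs)

  star? : Decidable R → Decidable (Star R)
  star? R? i j = map′ (through⇒star (allFin n)) star⇒through (through? R? (allFin n) i j)

-- The first step out of `P` comes with the path before it, so that its start is known to be
-- reachable from `x`.
step-leaving : ∀ {a r p} {A : Set a} {R : Rel A r} {P : U.Pred A p} → U.Decidable P →
               ∀ {x y} → Star R x y → P x → ¬ P y →
               ∃₂ λ u v → Star R x u × R u v × P u × ¬ P v
step-leaving P? ε px ¬py = contradiction px ¬py
step-leaving P? {x} (_◅_ {j = z} r rs) px ¬py with P? z
... | no ¬pz = x , z , ε , r , px , ¬pz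
... | yes pz with step-leaving P? rs pz ¬py
...   | u , v , path , edge , pu , ¬pv = u , v , r ◅ path , edge , pu , ¬pv

module _ {n p} {P : U.Pred (Fin n) p} (P? : U.Decidable P) where

  extension : Subset n
  extension = tabulate (λ i → does (P? i))

  ∈-extension⁺ : ∀ {i} → P i → i ∈ extension
  ∈-extension⁺ {i} pi = lookup⇒[]= i _ (trans (lookup∘tabulate _ i) (dec-true (P? i) pi))

  ∈-extension⁻ : ∀ {i} → i ∈ extension → P i
  ∈-extension⁻ {i} i∈ with P? i | trans (sym (lookup∘tabulate (λ j → does (P? j)) i)) ([]=⇒lookup i∈)
  ... | yes pi | _ = pi

∣p∪⁅x⁆∣≡1+∣p∣ : ∀ {n} (p : Subset n) {x} → x ∉ p → ∣ p ∪ ⁅ x ⁆ ∣ ≡ suc ∣ p ∣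
∣p∪⁅x⁆∣≡1+∣p∣ (inside  ∷ p) {zero}  x∉ = contradiction here x∉
∣p∪⁅x⁆∣≡1+∣p∣ (outside ∷ p) {zero}  x∉ = cong (suc ∘ ∣_∣) (∪-identityʳ p)
∣p∪⁅x⁆∣≡1+∣p∣ (inside  ∷ p) {suc x} x∉ = cong suc (∣p∪⁅x⁆∣≡1+∣p∣ p (x∉ ∘ there))
∣p∪⁅x⁆∣≡1+∣p∣ (outside ∷ p) {suc x} x∉ = ∣p∪⁅x⁆∣≡1+∣p∣ p (x∉ ∘ there)

-- Separation of points by chords

-- Comparisons are Boolean so that separation becomes a parity, to be checked by truth tables.
lt : ∀ {n} → Fin n → Fin n → Bool
lt i j = does (i <? j)

module _ {n} {x y : Fin n} where

  lt-yes : x < y → lt x y ≡ true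
  lt-yes = dec-true (x <? y)

  lt-no : y < x → lt x y ≡ false
  lt-no y<x = dec-false (x <? y) (<-asym y<x)

  lt-flip : x ≢ y → lt y x ≡ not (lt x y)
  lt-flip x≢y with <-cmp x y
  ... | tri< x<y _ _ = trans (dec-false (y <? x) (<-asym x<y)) (cong not (sym (lt-yes x<y)))
  ... | tri≈ _ x≡y _ = contradiction x≡y x≢y
  ... | tri> _ _ y<x = trans (dec-true (y <? x) y<x) (cong not (sym (lt-no y<x)))

-- For `β = true` this is transitivity of `<`, for `β = false` that of its negation, so mirror-image
-- cases share one argument.
lt-trans : ∀ {n} {x y z : Fin n} {β} → lt x y ≡ β → lt y z ≡ β → lt x z ≡ β
lt-trans {x = x} {y} {z} {false} xy yz = dec-false (x <? z) (ℕ.≤⇒≯ (ℕ.≤-trans (≥ yz) (≥ xy)))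
  where
  ≥ : ∀ {i j} → lt i j ≡ false → toℕ j ℕ.≤ toℕ i
  ≥ {i} {j} eq = ℕ.≮⇒≥ λ i<j → case trans (sym eq) (dec-true (i <? j) i<j) of λ ()
lt-trans {x = x} {y} {z} {true} xy yz = dec-true (x <? z) (<-trans (less xy) (less yz))
  where
  less : ∀ {i j} → lt i j ≡ true → i < j
  less {i} {j} eq = decidable-stable (i <? j) λ i≮j →
    case trans (sym eq) (dec-false (i <? j) i≮j) of λ ()

-- Which of the two arcs cut off by the chord cd contains x. Two points are separated
-- by the chord when their sides differ, so that non-separation is transitive.
side : ∀ {n} → Fin n → Fin n → Fin n → Bool
side c d x = lt x c xor lt x d

side-swap : ∀ {n} (c d x : Fin n) → side d c x ≡ side c d x
side-swap c d x = xor-comm (lt x d) (lt x c)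

side-degenerate : ∀ {n} (c x : Fin n) → side c c x ≡ false
side-degenerate c x = xor-same (lt x c)

-- The chords `ab` and `cd` have no common end, but either may degenerate to a point.
Apart : ∀ {n} (a b c d : Fin n) → Set
Apart a b c d = a ≢ c × a ≢ d × b ≢ c × b ≢ d

apart-swap : ∀ {n} {a b c d : Fin n} → Apart a b c d → Apart b a c d
apart-swap (ac , ad , bc , bd) = bc , bd , ac , ad

apart-flip : ∀ {n} {a b c d : Fin n} → Apart a b c d → Apart c d a b
apart-flip (ac , ad , bc , bd) = ≢-sym ac , ≢-sym bc , ≢-sym ad , ≢-sym bd

-- Both equations say that the four comparisons between an end of `ab` and an end of `cd` have even
-- parity. Exchanging the chords negates all four, which preserves the parity.
side-flip : ∀ {n} {a b c d : Fin n} → Apart a b c d →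
            side c d a ≡ side c d b → side a b c ≡ side a b d
side-flip {a = a} {b} {c} {d} (ac , ad , bc , bd) eq =
  trans (cong₂ _xor_ (lt-flip ac) (lt-flip bc))
    (trans (exchange (lt a c) (lt a d) (lt b c) (lt b d) eq)
      (sym (cong₂ _xor_ (lt-flip ad) (lt-flip bd))))
  where
  exchange : ∀ p q r s → p xor q ≡ r xor s → not p xor not r ≡ not q xor not s
  exchange true  true  true  true  _ = refl
  exchange true  true  false false _ = refl
  exchange true  false true  false _ = refl
  exchange true  false false true  _ = refl
  exchange false true  true  false _ = refl
  exchange false true  false true  _ = refl
  exchange false false true  true  _ = refl
  exchange false false false false _ = refl

-- What matters is that the right-hand side does not depend on y.
side-separated : ∀ {n} {a p q y : Fin n} → a ≢ p → a ≢ q → y ≢ p →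
                 side p q a ≢ side p q y →
                 side a p y ≡ (if side p q a then false else lt a p xor lt p q)
side-separated {a = a} {p} {q} {y} a≢p a≢q y≢p ne =
  go (lt a p) (lt a q) (lt y p) (lt y q) refl refl refl refl ne
  where
  -- Here `x` lies between `y` and `a` and so decides their order.
  via : ∀ x {β} → a ≢ x → lt y x ≡ β → lt a x ≡ not β → lt y a ≡ β
  via x {β} a≢x yx ax = lt-trans {x = y} {x} {a} yx
    (trans (lt-flip a≢x) (trans (cong not ax) (not-involutive β)))

  -- Here `y` lies between `p` and `q` and decides theirs.
  pq : ∀ {β} → lt y p ≡ β → lt y q ≡ not β → lt p q ≡ not β
  pq yp yq = lt-trans {x = p} {y} {q} (trans (lt-flip y≢p) (cong not yp)) yq

  -- Since `a` and `y` are on different sides of `pq`, exactly one of `p` and `q` lies between them;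
  -- that one is passed to `via`. The other eight truth assignments put them on the same side.
  go : ∀ ap aq yp yq → lt a p ≡ ap → lt a q ≡ aq → lt y p ≡ yp → lt y q ≡ yq →
       ap xor aq ≢ yp xor yq →
       lt y a xor yp ≡ (if ap xor aq then false else ap xor lt p q)
  go true  true  true  false e₁ e₂ e₃ e₄ _ =
    trans (cong (_xor true) (via q a≢q e₄ e₂)) (sym (cong (true xor_) (pq e₃ e₄)))
  go true  true  false true  e₁ e₂ e₃ e₄ _ =
    trans (cong (_xor false) (via p a≢p e₃ e₁)) (sym (cong (true xor_) (pq e₃ e₄)))
  go true  false true  true  e₁ e₂ e₃ e₄ _ = cong (_xor true) (via q a≢q e₄ e₂)
  go true  false false false e₁ e₂ e₃ e₄ _ = cong (_xor false) (via p a≢p e₃ e₁)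
  go false true  true  true  e₁ e₂ e₃ e₄ _ = cong (_xor true) (via p a≢p e₃ e₁)
  go false true  false false e₁ e₂ e₃ e₄ _ = cong (_xor false) (via q a≢q e₄ e₂)
  go false false true  false e₁ e₂ e₃ e₄ _ =
    trans (cong (_xor true) (via p a≢p e₃ e₁)) (sym (cong (false xor_) (pq e₃ e₄)))
  go false false false true  e₁ e₂ e₃ e₄ _ =
    trans (cong (_xor false) (via q a≢q e₄ e₂)) (sym (cong (false xor_) (pq e₃ e₄)))
  go true  true  true  true  _ _ _ _ ne = contradiction refl ne
  go true  true  false false _ _ _ _ ne = contradiction refl ne
  go false false true  true  _ _ _ _ ne = contradiction refl ne
  go false false false false _ _ _ _ ne = contradiction refl ne
  go true  false true  false _ _ _ _ ne = contradiction refl ne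
  go true  false false true  _ _ _ _ ne = contradiction refl ne
  go false true  true  false _ _ _ _ ne = contradiction refl ne
  go false true  false true  _ _ _ _ ne = contradiction refl ne

-- Both `y` and `z` lie on the arc of `pq` opposite to `a`, and the chord `ap` does not divide that
-- arc.
same-side : ∀ {n} {a p q y z : Fin n} → a ≢ p → a ≢ q → y ≢ p → z ≢ p →
            side p q a ≢ side p q y → side p q a ≢ side p q z → side a p y ≡ side a p z
same-side a≢p a≢q y≢p z≢p sep-y sep-z =
  trans (side-separated a≢p a≢q y≢p sep-y) (sym (side-separated a≢p a≢q z≢p sep-z))

data Position {n} (c d x : Fin n) : Set where
  below  : x < c → side c d x ≡ false → Position c d x
  within : c < x → x < d → side c d x ≡ true → Position c d x
  above  : d < x → side c d x ≡ false → Position c d x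

position : ∀ {n} {c d x : Fin n} → c < d → x ≢ c → x ≢ d → Position c d x
position {c = c} {d} {x} c<d x≢c x≢d with <-cmp x c | <-cmp x d
... | tri≈ _ x≡c _ | _            = contradiction x≡c x≢c
... | _            | tri≈ _ x≡d _ = contradiction x≡d x≢d
... | tri< x<c _ _ | _            = below x<c (cong₂ _xor_ (lt-yes x<c) (lt-yes (<-trans x<c c<d)))
... | tri> _ _ c<x | tri< x<d _ _ = within c<x x<d (cong₂ _xor_ (lt-no c<x) (lt-yes x<d))
... | tri> _ _ c<x | tri> _ _ d<x = above d<x (cong₂ _xor_ (lt-no c<x) (lt-no d<x))

interleaving : ∀ {n} {a b c d : Fin n} → a < b → c < d → Apart a b c d →
              side c d a ≢ side c d b → (a < c × c < b × b < d) ⊎ (c < a × a < d × d < b)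
interleaving a<b c<d (ac , ad , bc , bd) ne with position c<d ac ad | position c<d bc bd
... | below _ s₁    | below _ s₂     = contradiction (trans s₁ (sym s₂)) ne
... | below a<c _   | within c<b b<d _ = inj₁ (a<c , c<b , b<d)
... | below _ s₁    | above _ s₂     = contradiction (trans s₁ (sym s₂)) ne
... | within c<a _ _ | below b<c _     = contradiction (<-trans b<c c<a) (<-asym a<b)
... | within _ _ s₁ | within _ _ s₂  = contradiction (trans s₁ (sym s₂)) ne
... | within c<a a<d _ | above d<b _  = inj₂ (c<a , a<d , d<b)
... | above _ s₁    | below _ s₂     = contradiction (trans s₁ (sym s₂)) ne
... | above d<a _   | within _ b<d _ = contradiction (<-trans b<d d<a) (<-asym a<b)
... | above _ s₁    | above _ s₂     = contradiction (trans s₁ (sym s₂)) ne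

-- This passes from parities back to the order: up to exchanging the ends of a chord, or the two
-- chords, separation means `a < c < b < d`.
separated-elim : ∀ {n q} (Q : Fin n → Fin n → Fin n → Fin n → Set q) →
                 (∀ {a b c d} → Q a b c d → Q b a c d) →
                 (∀ {a b c d} → Q a b c d → Q c d a b) →
                 (∀ {a b c d} → a < c → c < b → b < d → Q a b c d) →
                 ∀ {a b c d} → Apart a b c d → side c d a ≢ side c d b → Q a b c d
separated-elim {n} Q swap flip base apart ne = unordered apart ne
  where
  swapʳ : ∀ {a b c d} → Q a b c d → Q a b d c
  swapʳ = flip ∘ swap ∘ flip

  ordered : ∀ {a b c d} → a < b → c < d → Apart a b c d → side c d a ≢ side c d b → Q a b c d
  ordered a<b c<d apart ne with interleaving a<b c<d apart ne
  ... | inj₁ (a<c , c<b , b<d) = base a<c c<b b<d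
  ... | inj₂ (c<a , a<d , d<b) = flip (base c<a a<d d<b)

  half-ordered : ∀ {a b c d} → a < b → Apart a b c d → side c d a ≢ side c d b → Q a b c d
  half-ordered {a} {b} {c} {d} a<b apart ne with <-cmp c d
  ... | tri< c<d _ _  = ordered a<b c<d apart ne
  ... | tri≈ _ refl _ = contradiction (trans (side-degenerate c a) (sym (side-degenerate c b))) ne
  ... | tri> _ _ d<c  = swapʳ (ordered a<b d<c (apart-flip (apart-swap (apart-flip apart)))
          λ eq → ne (trans (side-swap d c a) (trans eq (side-swap c d b))))

  unordered : ∀ {a b c d} → Apart a b c d → side c d a ≢ side c d b → Q a b c d
  unordered {a} {b} apart ne with <-cmp a b
  ... | tri< a<b _ _  = half-ordered a<b apart ne
  ... | tri≈ _ refl _ = contradiction refl ne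
  ... | tri> _ _ b<a  = swap (half-ordered b<a (apart-swap apart) (≢-sym ne))

-- Planar equivalence relations

-- This is the noncrossing condition on partitions, freed from any ordering of the four points.
Planar : ∀ {n} → Rel (Fin n) 0ℓ → Set
Planar _~_ = ∀ {a b c d} → a ~ b → c ~ d → ¬ a ~ c → side c d a ≡ side c d b

-- The vertex `d` stands for its class, which must avoid those of `a` and `b`. Recording vertices in
-- place of classes makes the separators a `Subset n`, ready for descent along inclusion.
Separator : ∀ {n} → Rel (Fin n) 0ℓ → (a b d : Fin n) → Set
Separator _~_ a b d = ¬ d ~ a × ¬ d ~ b × ∃ λ d′ → d ~ d′ × side d d′ a ≢ side d d′ b

separator? : ∀ {n} {_~_ : Rel (Fin n) 0ℓ} → Decidable _~_ → ∀ a b → U.Decidable (Separator _~_ a b)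
separator? _~?_ a b d = ¬? (d ~? a) ×-dec ¬? (d ~? b) ×-dec
  any? (λ d′ → (d ~? d′) ×-dec ¬? (side d d′ a ≟ᵇ side d d′ b))

separator-swap : ∀ {n} (_~_ : Rel (Fin n) 0ℓ) a b d → Separator _~_ a b d → Separator _~_ b a d
separator-swap _ _ _ _ (d≁a , d≁b , d′ , d~d′ , sep) = d≁b , d≁a , d′ , d~d′ , ≢-sym sep

module _ {n} {_~_ : Rel (Fin n) 0ℓ} (~-isEquivalence : IsEquivalence _~_) where
  open IsEquivalence ~-isEquivalence renaming (refl to ~-refl; sym to ~-sym; trans to ~-trans)

  apart : ∀ {a b c d} → ¬ c ~ a → ¬ c ~ b → c ~ d → Apart a b c d
  apart c≁a c≁b c~d = (λ { refl → c≁a ~-refl }) , (λ { refl → c≁a c~d }) ,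
                      (λ { refl → c≁b ~-refl }) , (λ { refl → c≁b c~d })

  -- If `dd′` did not separate `a` from `b`, it would separate both of them from `p`. Then both
  -- would lie on the side of `pq` that contains `d`, although `pq` separates them.
  separator-shrinks : Planar _~_ → ∀ {a b p q} → ¬ p ~ a → ¬ p ~ b → p ~ q →
                      side p q a ≢ side p q b →
                      ∀ {d} → Separator _~_ a p d → Separator _~_ a b d
  separator-shrinks planar {a} {b} {p} {q} p≁a p≁b p~q sep {d} (d≁a , d≁p , d′ , d~d′ , sep′) =
    d≁a , d≁b , d′ , d~d′ , λ eq →
      sep (trans (on-side-of-d d≁a p≁a sep′)
            (sym (on-side-of-d d≁b p≁b λ eq′ → sep′ (trans eq eq′))))
    where
    p≁d : ¬ p ~ d
    p≁d = d≁p ∘ ~-sym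

    -- Otherwise dd′ is on the b-side of the chord pq, hence does not separate a from p.
    d≁b : ¬ d ~ b
    d≁b d~b = sep′ (side-flip (apart-flip (apart d≁a d≁p d~d′))
      (same-side (proj₁ a-pq) (proj₁ (proj₂ a-pq)) (≢-p ~-refl) (≢-p d~d′)
                 (sep-from-a ~-refl) (sep-from-a d~d′)))
      where
      a-pq = apart p≁a p≁b p~q

      ≢-p : ∀ {z} → d ~ z → z ≢ p
      ≢-p d~z refl = d≁p d~z

      sep-from-a : ∀ {z} → d ~ z → side p q a ≢ side p q z
      sep-from-a d~z eq = sep (trans eq
        (planar (~-trans (~-sym d~z) d~b) p~q λ z~p → d≁p (~-trans d~z z~p)))

    -- By planarity `p` and `q` lie on the same side of `dd′`, opposite to `x`. So the chord `xd`
    -- does not separate them, and flipping the chords gives the claim.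
    on-side-of-d : ∀ {x} → ¬ d ~ x → ¬ p ~ x → side d d′ x ≢ side d d′ p → side p q x ≡ side p q d
    on-side-of-d d≁x p≁x ne =
      let x≢d , x≢d′ , p≢d , _ = apart d≁x d≁p d~d′
          _ , _ , _ , d≢q = apart p≁x p≁d p~q
      in side-flip (apart-flip (apart p≁x p≁d p~q))
           (same-side x≢d x≢d′ p≢d (≢-sym d≢q) ne
             λ eq → ne (trans eq (sym (planar p~q d~d′ p≁d))))

star-isEquivalence : ∀ {n} (H : Graph n) → IsEquivalence (Star (Adj H))
star-isEquivalence H = record { refl = ε ; sym = reverse (Graph.adj-sym H) ; trans = _◅◅_ }

adj? : ∀ {n} (H : Graph n) → Decidable (Adj H)
adj? H i j = T? (Graph.adj H i j)

module _ {n} (H : Graph n) where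
  open IsEquivalence (star-isEquivalence H) using () renaming (sym to ~-sym)

  noncrossing⇒planar : IsNoncrossing H → Planar (Star (Adj H))
  noncrossing⇒planar noncrossing {a} {b} {c} {d} a~b c~d a≁c =
    decidable-stable (side c d a ≟ᵇ side c d b) λ ne →
      separated-elim Q
        (λ q b~a c~d b≁c → q (~-sym b~a) c~d λ a~c → b≁c (b~a ◅◅ a~c))
        (λ q c~d a~b c≁a → q a~b c~d (c≁a ∘ ~-sym))
        (λ a<c c<b b<d a~b c~d a≁c →
          noncrossing _ _ (λ (a⊆c , _) → a≁c (~-sym (a⊆c ε))) ε a~b ε c~d (a<c , c<b , b<d))
        (apart (star-isEquivalence H) (a≁c ∘ ~-sym) (λ c~b → a≁c (a~b ◅◅ ~-sym c~b)) c~d)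
        ne a~b c~d a≁c
    where
    -- Double negation suffices because `a≁c` is to be refuted. Only the two components matter, so
    -- the statement survives the exchanges made by `separated-elim`.
    Q : Fin n → Fin n → Fin n → Fin n → Set
    Q a b c d = Star (Adj H) a b → Star (Adj H) c d → ¬ ¬ Star (Adj H) a c

  planar⇒noncrossing : Planar (Star (Adj H)) → IsNoncrossing H
  planar⇒noncrossing planar u v u≉v {a} {b} {c} {d} u~a u~c v~b v~d (a<b , b<c , c<d) =
    case trans (sym a-side) (trans (planar (~-sym u~a ◅◅ u~c) (~-sym v~b ◅◅ v~d) a≁b) c-side)
      of λ ()
    where
    a≁b : ¬ Star (Adj H) a b
    a≁b a~b = let u~v = u~a ◅◅ a~b ◅◅ ~-sym v~b in
      u≉v ((λ u~w → ~-sym u~v ◅◅ u~w) , (λ v~w → u~v ◅◅ v~w))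

    a-side : side b d a ≡ false
    a-side = cong₂ _xor_ (lt-yes a<b) (lt-yes (<-trans a<b (<-trans b<c c<d)))

    c-side : side b d c ≡ true
    c-side = cong₂ _xor_ (lt-no b<c) (lt-yes c<d)

endpoint : ∀ {n} (H : Graph n) {i j k} → Adj H i j → k ≡ i ⊎ k ≡ j → Star (Adj H) i k
endpoint H ij (inj₁ refl) = ε
endpoint H ij (inj₂ refl) = return ij

-- A path that changes sides does so in a single step. This turns crossing components into crossing
-- edges.
straddling-step : ∀ {n} {R : Rel (Fin n) 0ℓ} a b {c d} → Star R c d → side a b c ≢ side a b d →
                  ∃₂ λ p q → Star R c p × R p q × side a b p ≢ side a b q
straddling-step a b {c} path ne
  with step-leaving (λ z → side a b c ≟ᵇ side a b z) path refl ne
... | p , q , c~p , pq , eq , ne′ = p , q , c~p , pq , λ eq′ → ne′ (trans eq eq′)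

-- Tightly closed graphs

Joined : ∀ {n} → Graph n → (a b c d : Fin n) → Set
Joined G a b c d = ∃₂ λ u v → (u ≡ a ⊎ u ≡ b) × (v ≡ c ⊎ v ≡ d) × Adj G u v

module _ {n} {G : Graph n} (tight : TightlyClosed G) where

  private
    -- The connected set `J(e,f)` contains a path from `a` to `c`. The step by which it first leaves
    -- the ends of `e` must arrive at an end of `f`, as there is no other vertex.
    crossing-joined : (e f : Edge G) → Crossing e f →
                      Joined G (Edge.lo e) (Edge.hi e) (Edge.lo f) (Edge.hi f)
    crossing-joined e f e×f with proj₁ tight e f e×f | proj₂ tight e f e×f
    ... | S , ((connected , (a∈ , b∈) , (c∈ , d∈)) , _) , _ | φ , φ-injective , _ =
      joined (step-leaving (λ v → v ≟ a ⊎-dec v ≟ b) (connected a∈ c∈) (inj₁ refl) c∉ab)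
      where
      open Edge e renaming (lo to a; hi to b; lo<hi to a<b)
      open Edge f renaming (lo to c; hi to d; lo<hi to c<d)

      <⇒≢ : ∀ {i j : Fin n} → i < j → i ≢ j
      <⇒≢ i<j refl = <-irrefl refl i<j

      ab-apart-cd : Apart a b c d
      ab-apart-cd = case e×f of λ where
        (inj₁ (a<c , c<b , b<d)) →
          <⇒≢ a<c , <⇒≢ (<-trans a<b b<d) , ≢-sym (<⇒≢ c<b) , <⇒≢ b<d
        (inj₂ (c<a , a<d , d<b)) →
          ≢-sym (<⇒≢ c<a) , <⇒≢ a<d , ≢-sym (<⇒≢ (<-trans c<a a<b)) , ≢-sym (<⇒≢ d<b)

      c∉ab : ¬ (c ≡ a ⊎ c ≡ b)
      c∉ab (inj₁ c≡a) = proj₁ ab-apart-cd (sym c≡a)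
      c∉ab (inj₂ c≡b) = proj₁ (proj₂ (proj₂ ab-apart-cd)) (sym c≡b)

      -- A fifth vertex would contradict the embedding of S into K₄.
      only-endpoints : ∀ {v} → v ∈ S → ¬ (v ≡ a ⊎ v ≡ b) → v ≡ c ⊎ v ≡ d
      only-endpoints {v} v∈ v∉ab with v ≟ c | v ≟ d
      ... | yes v≡c | _       = inj₁ v≡c
      ... | no _    | yes v≡d = inj₂ v≡d
      ... | no v≢c  | no v≢d  = contradiction
            (injective⇒≤ {f = λ i → φ (lookup vertices i)} λ {i} {j} eq →
              lookup-injective distinct i j (φ-injective (inside-S i) (inside-S j) eq))
            1+n≰n
        where
        vertices = v ∷ a ∷ b ∷ c ∷ d ∷ []
        a≢c = proj₁ ab-apart-cd
        a≢d = proj₁ (proj₂ ab-apart-cd)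
        b≢c = proj₁ (proj₂ (proj₂ ab-apart-cd))
        b≢d = proj₂ (proj₂ (proj₂ ab-apart-cd))

        distinct : Unique vertices
        distinct = ((v∉ab ∘ inj₁) ∷ (v∉ab ∘ inj₂) ∷ v≢c ∷ v≢d ∷ []) ∷
                   (<⇒≢ a<b ∷ a≢c ∷ a≢d ∷ []) ∷ (b≢c ∷ b≢d ∷ []) ∷ (<⇒≢ c<d ∷ []) ∷ [] ∷ []

        inside-S : ∀ i → lookup vertices i ∈ S
        inside-S = lookupAll {P = _∈ S} (v∈ ∷ a∈ ∷ b∈ ∷ c∈ ∷ d∈ ∷ [])

      joined : (∃₂ λ u v → Star (InducedAdj G S) a u × InducedAdj G S u v ×
                           (u ≡ a ⊎ u ≡ b) × ¬ (v ≡ a ⊎ v ≡ b)) → Joined G a b c d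
      joined (u , v , _ , (_ , v∈ , uv) , u∈ab , v∉ab) = u , v , u∈ab , only-endpoints v∈ v∉ab , uv

  separated-joined : ∀ {a b c d} → Adj G a b → Adj G c d → Apart a b c d →
                     side c d a ≢ side c d b → Joined G a b c d
  separated-joined ab cd apart ne =
    separated-elim (λ a b c d → Adj G a b → Adj G c d → Joined G a b c d)
      (λ q ba cd → let u , v , u∈ , v∈ , uv = q (Graph.adj-sym G ba) cd in
                   u , v , swap⊎ u∈ , v∈ , uv)
      (λ q cd ab → let u , v , u∈ , v∈ , uv = q ab cd in v , u , v∈ , u∈ , Graph.adj-sym G uv)
      (λ {a} {b} {c} {d} a<c c<b b<d ab cd →
        crossing-joined
          (record { lo = a ; hi = b ; lo<hi = <-trans a<c c<b ; lo~hi = ab })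
          (record { lo = c ; hi = d ; lo<hi = <-trans c<b b<d ; lo~hi = cd })
          (inj₁ (a<c , c<b , b<d)))
      apart ne ab cd

  -- Crossing components would contain crossing edges: the path from `a` to `b` is cut down to an
  -- edge separated by `cd`, then the path from `c` to `d` to an edge separated by that one.
  -- Tightness joins the two edges, so the components coincide.
  tight⇒planar : Planar (Star (Adj G))
  tight⇒planar {a} {b} {c} {d} a~b c~d a≁c = decidable-stable (side c d a ≟ᵇ side c d b) λ ne →
    let u , v , a~u , uv , ne₁ = straddling-step c d a~b ne
        c≁u = λ c~u → a≁c (a~u ◅◅ ~-sym c~u)
        c≁v = λ c~v → a≁c (a~u ◅◅ uv ◅ ~-sym c~v)
        p , q , c~p , pq , ne₂ = straddling-step u v c~d
          (ne₁ ∘ side-flip (apart-flip (apart ~-isEquivalence c≁u c≁v c~d)))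
        p≁u = λ p~u → c≁u (c~p ◅◅ p~u)
        p≁v = λ p~v → c≁v (c~p ◅◅ p~v)
        uv-apart-pq = apart ~-isEquivalence p≁u p≁v (return pq)
        s , t , s∈ , t∈ , st = separated-joined uv pq uv-apart-pq
          (ne₂ ∘ side-flip uv-apart-pq)
    in a≁c (a~u ◅◅ endpoint G uv s∈ ◅◅ st ◅ ~-sym (endpoint G pq t∈) ◅◅ ~-sym c~p)
    where
    ~-isEquivalence = star-isEquivalence G
    open IsEquivalence ~-isEquivalence using () renaming (sym to ~-sym)

-- Rank and covers of noncrossing bonds

NonLeast : ∀ {n} → Graph n → U.Pred (Fin n) 0ℓ
NonLeast H v = ∃ λ u → u < v × Star (Adj H) v u

nonLeast? : ∀ {n} (H : Graph n) → U.Decidable (NonLeast H)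
nonLeast? H v = any? (λ u → u <? v ×-dec star? (adj? H) v u)

-- Number of vertices minus number of components, as every component has one least vertex.
rank : ∀ {n} → Graph n → ℕ
rank H = ∣ extension (nonLeast? H) ∣

rank-cong : ∀ {n} (H K : Graph n) → (∀ {i j} → Adj H i j → Adj K i j) →
            (∀ {i j} → Adj K i j → Adj H i j) → rank H ≡ rank K
rank-cong H K H⊆K K⊆H = cong ∣_∣ (⊆-antisym (mono H K H⊆K) (mono K H K⊆H))
  where
  mono : ∀ H K → (∀ {i j} → Adj H i j → Adj K i j) →
         extension (nonLeast? H) ⊆ extension (nonLeast? K)
  mono H K H⊆K v∈ = let u , u<v , path = ∈-extension⁻ (nonLeast? H) v∈ in
    ∈-extension⁺ (nonLeast? K) (u , u<v , mapStar H⊆K path)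

least : ∀ {n} (H : Graph n) v → ∃ λ m → Star (Adj H) v m × ¬ NonLeast H m
least H v = go v (<-wellFounded v)
  where
  go : ∀ v → Acc _<_ v → ∃ λ m → Star (Adj H) v m × ¬ NonLeast H m
  go v (acc rs) with nonLeast? H v
  ... | no least = v , ε , least
  ... | yes (u , u<v , v~u) = let m , u~m , least = go u (rs u<v) in m , v~u ◅◅ u~m , least

-- Merging two unseparated components

module Merge {n} {G : Graph n} (A : NoncrossingBond G) {a b : Fin n} (ab : Adj G a b)
             (a≁b : ¬ Star (Adj (graph A)) a b)
             (unseparated : ∀ d → ¬ Separator (Star (Adj (graph A))) a b d) where

  private
    infix 4 _~_ _≋_

    _~_ : Rel (Fin n) 0ℓ
    _~_ = Star (Adj (graph A))

    ~-isEquivalence = star-isEquivalence (graph A)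
    open IsEquivalence ~-isEquivalence using () renaming (sym to ~-sym)

    InMerged : Fin n → Set
    InMerged i = i ~ a ⊎ i ~ b

    inMerged-resp : ∀ {i j} → i ~ j → InMerged j → InMerged i
    inMerged-resp i~j (inj₁ j~a) = inj₁ (i~j ◅◅ j~a)
    inMerged-resp i~j (inj₂ j~b) = inj₂ (i~j ◅◅ j~b)

  -- The coarser partition is given explicitly; `component⇒≋` and `≋⇒component` identify its classes
  -- with the components of `merged-graph`.
  _≋_ : Rel (Fin n) 0ℓ
  i ≋ j = i ~ j ⊎ InMerged i × InMerged j

  private
    ≋-sym : ∀ {i j} → i ≋ j → j ≋ i
    ≋-sym (inj₁ i~j)     = inj₁ (~-sym i~j)
    ≋-sym (inj₂ (i∈ , j∈)) = inj₂ (j∈ , i∈)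

    ≋-trans : ∀ {i j k} → i ≋ j → j ≋ k → i ≋ k
    ≋-trans (inj₁ i~j)      (inj₁ j~k)      = inj₁ (i~j ◅◅ j~k)
    ≋-trans (inj₁ i~j)      (inj₂ (j∈ , k∈)) = inj₂ (inMerged-resp i~j j∈ , k∈)
    ≋-trans (inj₂ (i∈ , j∈)) (inj₁ j~k)      = inj₂ (i∈ , inMerged-resp (~-sym j~k) j∈)
    ≋-trans (inj₂ (i∈ , _)) (inj₂ (_ , k∈)) = inj₂ (i∈ , k∈)

    merged-adj? : ∀ i j → Dec (Adj G i j × i ≋ j)
    merged-adj? i j = adj? G i j ×-dec (i ~? j ⊎-dec (inMerged? i ×-dec inMerged? j))
      where
      _~?_ = star? (adj? (graph A))

      inMerged? : U.Decidable InMerged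
      inMerged? k = (k ~? a) ⊎-dec (k ~? b)

  merged-graph : Graph n
  merged-graph = record
    { adj        = λ i j → isYes (merged-adj? i j)
    ; adj-sym    = λ {i} {j} ij → let g , i≋j = toWitness {a? = merged-adj? i j} ij in
                     fromWitness (Graph.adj-sym G g , ≋-sym i≋j)
    ; adj-irrefl = λ {i} ii → Graph.adj-irrefl G (proj₁ (toWitness {a? = merged-adj? i i} ii))
    }

  private
    K = merged-graph

    adj⁻ : ∀ {i j} → Adj K i j → Adj G i j × i ≋ j
    adj⁻ {i} {j} = toWitness {a? = merged-adj? i j}

    adj⁺ : ∀ {i j} → Adj G i j → i ≋ j → Adj K i j
    adj⁺ g i≋j = fromWitness (g , i≋j)

  component⇒≋ : ∀ {i j} → Star (Adj K) i j → i ≋ j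
  component⇒≋ ε        = inj₁ ε
  component⇒≋ (e ◅ es) = ≋-trans (proj₂ (adj⁻ e)) (component⇒≋ es)

  A⊆merged : ∀ {i j} → Adj (graph A) i j → Adj K i j
  A⊆merged ij = adj⁺ (proj₁ (isBond A) ij) (inj₁ (return ij))

  -- The graph `H` is kept general to serve twice: for the merged graph itself and for an upper
  -- bound `B`.
  ≋⇒component : ∀ (H : Graph n) → (∀ {i j} → Adj (graph A) i j → Adj H i j) → Adj H a b →
                ∀ {i j} → i ≋ j → Star (Adj H) i j
  ≋⇒component H A⊆H ab (inj₁ i~j)       = mapStar A⊆H i~j
  ≋⇒component H A⊆H ab (inj₂ (i∈ , j∈)) = to-a i∈ ◅◅ reverse (Graph.adj-sym H) (to-a j∈)
    where
    to-a : ∀ {i} → InMerged i → Star (Adj H) i a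
    to-a (inj₁ i~a) = mapStar A⊆H i~a
    to-a (inj₂ i~b) = mapStar A⊆H i~b ◅◅ return (Graph.adj-sym H ab)

  private
    ≋⇒merged-component : ∀ {i j} → i ≋ j → Star (Adj K) i j
    ≋⇒merged-component = ≋⇒component K A⊆merged (adj⁺ ab (inj₂ (inj₁ ε , inj₂ ε)))

    planarA : Planar _~_
    planarA = noncrossing⇒planar (graph A) (noncrossing A)

    unseparated-side : ∀ {c d} → ¬ InMerged c → c ~ d → side c d a ≡ side c d b
    unseparated-side {c} {d} c∉ c~d = decidable-stable (side c d a ≟ᵇ side c d b) λ ne →
      unseparated c (c∉ ∘ inj₁ , c∉ ∘ inj₂ , d , c~d , ne)

    -- Planarity of `A` keeps each old component on one side of `cd`, and `unseparated` puts the two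
    -- on the same side.
    merged-side : ∀ {i c d} → InMerged i → ¬ InMerged c → c ~ d → side c d i ≡ side c d a
    merged-side (inj₁ i~a) c∉ c~d = planarA i~a c~d λ i~c → c∉ (inj₁ (~-sym i~c ◅◅ i~a))
    merged-side (inj₂ i~b) c∉ c~d = trans
      (planarA i~b c~d λ i~c → c∉ (inj₂ (~-sym i~c ◅◅ i~b))) (sym (unseparated-side c∉ c~d))

    ≋-planar : Planar _≋_
    ≋-planar (inj₁ i~j) (inj₁ k~l) i≭k = planarA i~j k~l (i≭k ∘ inj₁)
    ≋-planar (inj₂ (i∈ , j∈)) (inj₂ (k∈ , _)) i≭k = contradiction (inj₂ (i∈ , k∈)) i≭k
    ≋-planar (inj₂ (i∈ , j∈)) (inj₁ k~l) i≭k =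
      trans (merged-side i∈ k∉ k~l) (sym (merged-side j∈ k∉ k~l))
      where k∉ = λ k∈ → i≭k (inj₂ (i∈ , k∈))
    -- The chord now lies in the merged class, so the two chords are exchanged first.
    ≋-planar (inj₁ i~j) (inj₂ (k∈ , l∈)) i≭k =
      side-flip (apart ~-isEquivalence (i∉ ∘ ~⇒∈ k∈) (i∉ ∘ ~⇒∈ l∈) i~j)
        (trans (merged-side k∈ i∉ i~j) (sym (merged-side l∈ i∉ i~j)))
      where
      i∉ = λ i∈ → i≭k (inj₂ (i∈ , k∈))
      ~⇒∈ : ∀ {i k} → InMerged k → i ~ k → InMerged i
      ~⇒∈ k∈ i~k = inMerged-resp i~k k∈

  merged : NoncrossingBond G
  merged = record
    { graph       = K
    ; isBond      = (λ ij → proj₁ (adj⁻ ij)) ,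
                    (λ v v~i v~j g →
                       adj⁺ g (≋-trans (≋-sym (component⇒≋ v~i)) (component⇒≋ v~j)))
    ; noncrossing = planar⇒noncrossing K λ i~j k~l i≁k →
        ≋-planar (component⇒≋ i~j) (component⇒≋ k~l) (i≁k ∘ ≋⇒merged-component)
    }

  -- Classes of `≋` lie within components of `B`, and `B` contains every edge of `G` inside its
  -- components.
  merged-least : (B : NoncrossingBond G) → (∀ {i j} → Adj (graph A) i j → Adj (graph B) i j) →
                 Adj (graph B) a b → ∀ {i j} → Adj K i j → Adj (graph B) i j
  merged-least B A⊆B ab ij = let g , i≋j = adj⁻ ij in
    proj₂ (isBond B) _ ε (≋⇒component (graph B) A⊆B ab i≋j) g

  private
    -- Of the two least vertices only the larger one, `m′`, ceases to be least in its component.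
    -- Naming the halves by `m` and `m′` covers both possible orders.
    rank-merged′ : ∀ {m m′} → m < m′ → ¬ NonLeast (graph A) m → ¬ NonLeast (graph A) m′ →
                   InMerged m → InMerged m′ → (∀ {i} → InMerged i → i ~ m ⊎ i ~ m′) →
                   rank K ≡ suc (rank (graph A))
    rank-merged′ {m} {m′} m<m′ m-least m′-least m∈ m′∈ split =
      trans (cong ∣_∣ (⊆-antisym to from))
        (∣p∪⁅x⁆∣≡1+∣p∣ _ (m′-least ∘ ∈-extension⁻ (nonLeast? (graph A))))
      where
      nonLeast-merged : ∀ {v} → NonLeast K v → NonLeast (graph A) v ⊎ v ≡ m′
      nonLeast-merged {v} (u , u<v , path) with component⇒≋ path
      ... | inj₁ v~u = inj₁ (u , u<v , v~u)
      ... | inj₂ (v∈ , u∈) with split v∈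
      ...   | inj₂ v~m′ = case <-cmp v m′ of λ where
                (tri< v<m′ _ _) → contradiction (v , v<m′ , ~-sym v~m′) m′-least
                (tri≈ _ v≡m′ _) → inj₂ v≡m′
                (tri> _ _ m′<v) → inj₁ (m′ , m′<v , v~m′)
      ...   | inj₁ v~m = case <-cmp v m of λ where
                (tri< v<m _ _)  → contradiction (v , v<m , ~-sym v~m) m-least
                (tri≈ _ refl _) → case split u∈ of λ where
                  (inj₁ u~m)  → contradiction (u , u<v , ~-sym u~m) m-least
                  (inj₂ u~m′) → contradiction (u , <-trans u<v m<m′ , ~-sym u~m′) m′-least
                (tri> _ _ m<v)  → inj₁ (m , m<v , v~m)

      to : extension (nonLeast? K) ⊆ extension (nonLeast? (graph A)) ∪ ⁅ m′ ⁆
      to v∈ = x∈p∪q⁺ (case nonLeast-merged (∈-extension⁻ (nonLeast? K) v∈) of λ where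
        (inj₁ nonLeast) → inj₁ (∈-extension⁺ (nonLeast? (graph A)) nonLeast)
        (inj₂ refl)     → inj₂ (x∈⁅x⁆ m′))

      from : extension (nonLeast? (graph A)) ∪ ⁅ m′ ⁆ ⊆ extension (nonLeast? K)
      from v∈ = ∈-extension⁺ (nonLeast? K) (case x∈p∪q⁻ _ _ v∈ of λ where
        (inj₁ v∈A)  → let u , u<v , path = ∈-extension⁻ (nonLeast? (graph A)) v∈A in
                      u , u<v , mapStar A⊆merged path
        (inj₂ v∈m′) → case x∈⁅y⁆⇒x≡y m′ v∈m′ of λ where
          refl → m , m<m′ , ≋⇒merged-component (inj₂ (m′∈ , m∈)))

  rank-merged : rank K ≡ suc (rank (graph A))
  rank-merged with least (graph A) a | least (graph A) b
  ... | m , a~m , m-least | m′ , b~m′ , m′-least with <-cmp m m′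
  ...   | tri< m<m′ _ _ = rank-merged′ m<m′ m-least m′-least
            (inj₁ (~-sym a~m)) (inj₂ (~-sym b~m′)) λ where
              (inj₁ i~a) → inj₁ (i~a ◅◅ a~m)
              (inj₂ i~b) → inj₂ (i~b ◅◅ b~m′)
  ...   | tri≈ _ refl _ = contradiction (a~m ◅◅ ~-sym b~m′) a≁b
  ...   | tri> _ _ m′<m = rank-merged′ m′<m m′-least m-least
            (inj₂ (~-sym b~m′)) (inj₁ (~-sym a~m)) λ where
              (inj₁ i~a) → inj₂ (i~a ◅◅ a~m)
              (inj₂ i~b) → inj₁ (i~b ◅◅ b~m′)

-- Interpolation between comparable noncrossing bonds

module _ {n} {G : Graph n} (tight : TightlyClosed G) (A B : NoncrossingBond G)
         (A⊆B : ∀ {i j} → Adj (graph A) i j → Adj (graph B) i j) where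

  private
    _~_ : Rel (Fin n) 0ℓ
    _~_ = Star (Adj (graph A))

    ~-isEquivalence = star-isEquivalence (graph A)
    open IsEquivalence ~-isEquivalence using () renaming (sym to ~-sym)

    _~?_ : Decidable _~_
    _~?_ = star? (adj? (graph A))

    separators : Fin n → Fin n → Subset n
    separators a b = extension (separator? _~?_ a b)

    -- By tightness some edge joins an endpoint of ab to an endpoint of a separating edge pq.
    closer-edge : ∀ {a b d} → Adj (graph B) a b → Separator _~_ a b d →
                  ∃₂ λ u v → Adj (graph B) u v × ¬ u ~ v × separators u v ⊂ separators a b
    closer-edge {a} {b} {d} ab (d≁a , d≁b , d′ , d~d′ , d-separates)
      with straddling-step a b d~d′
             (d-separates ∘ side-flip (apart-flip (apart ~-isEquivalence d≁a d≁b d~d′)))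
    ... | p , q , d~p , pq , pq-straddles =
      joining-edge (separated-joined tight (proj₁ (isBond B) ab) (proj₁ (isBond A) pq)
        ab-apart-pq pq-separates)
      where
      p≁a : ¬ p ~ a
      p≁a p~a = d≁a (d~p ◅◅ p~a)

      p≁b : ¬ p ~ b
      p≁b p~b = d≁b (d~p ◅◅ p~b)

      ab-apart-pq = apart ~-isEquivalence p≁a p≁b (return pq)

      pq-separates : side p q a ≢ side p q b
      pq-separates = pq-straddles ∘ side-flip ab-apart-pq

      planarA : Planar _~_
      planarA = noncrossing⇒planar (graph A) (noncrossing A)

      -- Both `ab` and `pq` are edges of the noncrossing bond `B`, so their crossing puts them in
      -- one component. Being induced there, `B` contains the joining edge.
      a~ᴮp : Star (Adj (graph B)) a p
      a~ᴮp = decidable-stable (star? (adj? (graph B)) a p) λ a≁p →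
        pq-separates (noncrossing⇒planar (graph B) (noncrossing B)
          (return ab) (return (A⊆B pq)) a≁p)

      pq-separator : ∀ {v} → v ≡ p ⊎ v ≡ q → Separator _~_ a b v
      pq-separator (inj₁ refl) = p≁a , p≁b , q , return pq , pq-separates
      pq-separator (inj₂ refl) =
        (λ q~a → p≁a (pq ◅ q~a)) , (λ q~b → p≁b (pq ◅ q~b)) ,
        p , return (Graph.adj-sym (graph A) pq) ,
        λ eq → pq-separates (trans (side-swap q p a) (trans eq (side-swap p q b)))

      shrinks : ∀ {u v e} → u ≡ a ⊎ u ≡ b → Separator _~_ a b v →
                Separator _~_ u v e → Separator _~_ a b e
      shrinks (inj₁ refl) (v≁a , v≁b , v′ , v~v′ , sep) =
        separator-shrinks ~-isEquivalence planarA v≁a v≁b v~v′ sep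
      shrinks {e = e} (inj₂ refl) (v≁a , v≁b , v′ , v~v′ , sep) s =
        separator-swap _~_ b a e
          (separator-shrinks ~-isEquivalence planarA v≁b v≁a v~v′ (≢-sym sep) s)

      apart-from-separator : ∀ {u v} → u ≡ a ⊎ u ≡ b → Separator _~_ a b v → ¬ u ~ v
      apart-from-separator (inj₁ refl) (v≁a , _)     u~v = v≁a (~-sym u~v)
      apart-from-separator (inj₂ refl) (_ , v≁b , _) u~v = v≁b (~-sym u~v)

      joining-edge : Joined G a b p q →
                     ∃₂ λ u v → Adj (graph B) u v × ¬ u ~ v × separators u v ⊂ separators a b
      joining-edge (u , v , u∈ , v∈ , uv) = u , v ,
        proj₂ (isBond B) a (endpoint (graph B) ab u∈)
          (a~ᴮp ◅◅ endpoint (graph B) (A⊆B pq) v∈) uv ,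
        apart-from-separator u∈ (pq-separator v∈) ,
        (λ e∈ → ∈-extension⁺ (separator? _~?_ a b)
          (shrinks u∈ (pq-separator v∈) (∈-extension⁻ (separator? _~?_ u v) e∈))) ,
        -- Strictness: `v` separates `a` from `b`, whereas a separator of `u` and `v` avoids the
        -- component of `v`.
        v , ∈-extension⁺ (separator? _~?_ a b) (pq-separator v∈) ,
        λ v∈′ → proj₁ (proj₂ (∈-extension⁻ (separator? _~?_ u v) v∈′)) ε

  unseparated-edge : ∀ {a b} → Adj (graph B) a b → ¬ a ~ b →
                     ∃₂ λ u v → Adj (graph B) u v × ¬ u ~ v × (∀ d → ¬ Separator _~_ u v d)
  unseparated-edge {a} {b} = go a b (⊂-wellFounded (separators a b))
    where
    go : ∀ a b → Acc _⊂_ (separators a b) → Adj (graph B) a b → ¬ a ~ b →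
         ∃₂ λ u v → Adj (graph B) u v × ¬ u ~ v × (∀ d → ¬ Separator _~_ u v d)
    go a b (acc rs) ab a≁b with any? (separator? _~?_ a b)
    ... | no none = a , b , ab , a≁b , λ d s → none (d , s)
    ... | yes (d , s) = let u , v , uv , u≁v , smaller = closer-edge ab s in
          go u v (rs smaller) uv u≁v

  interpolation : (∃₂ λ a b → Adj (graph B) a b × ¬ Adj (graph A) a b) →
                  ∃ λ (C : NoncrossingBond G) →
                    (∀ {i j} → Adj (graph A) i j → Adj (graph C) i j) ×
                    (∀ {i j} → Adj (graph C) i j → Adj (graph B) i j) ×
                    rank (graph C) ≡ suc (rank (graph A))
  interpolation (a , b , ab , ¬ab) =
    -- A bond is induced on its components, so an edge of `G` missing from `A` joins different
    -- components of `A`.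
    let a≁b = λ a~b → ¬ab (proj₂ (isBond A) a ε a~b (proj₁ (isBond B) ab))
        u , v , uv , u≁v , unseparated = unseparated-edge ab a≁b
        open Merge A (proj₁ (isBond B) uv) u≁v unseparated
    in merged , A⊆merged , merged-least B A⊆B uv , rank-merged

-- Decidable comparison, bottom and top of the poset

included? : ∀ {n} (H K : Graph n) →
            (∀ {i j} → Adj H i j → Adj K i j) ⊎ ∃₂ λ i j → Adj H i j × ¬ Adj K i j
included? H K with any? (λ i → any? λ j → adj? H i j ×-dec ¬? (adj? K i j))
... | yes (i , j , h , ¬k) = inj₂ (i , j , h , ¬k)
... | no none = inj₁ λ {i} {j} h → decidable-stable (adj? K i j) λ ¬k → none (i , j , h , ¬k)

empty : ∀ {n} {G : Graph n} → NoncrossingBond G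
empty {n} {G} = record
  { graph       = record { adj = λ _ _ → false ; adj-sym = id ; adj-irrefl = id }
  ; isBond      = (λ ()) , λ { v ε ε g → Graph.adj-irrefl G g }
  ; noncrossing = λ { u v _ ε ε ε _ (a<b , b<c , _) → <-irrefl refl (<-trans a<b b<c) }
  }

full : ∀ {n} {G : Graph n} → TightlyClosed G → NoncrossingBond G
full {G = G} tight = record
  { graph       = G
  ; isBond      = id , λ _ _ _ → id
  ; noncrossing = planar⇒noncrossing G (tight⇒planar tight)
  }

theorem5p15 : (n : ℕ) (G : Graph n) → TightlyClosed G → Graded (NC G)
theorem5p15 n G tight = graded (NC G) ≈? (λ A → rank (graph A))
  (λ {A} {B} (A⊆B , B⊆A) → rank-cong (graph A) (graph B) A⊆B B⊆A)
  empty (full tight) (λ _ ()) (λ A → proj₁ (isBond A))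
  (λ {A} {B} → interpolate {A} {B})
  where
  open Poset (NC G) using (_≈_; _≤_)

  ≈? : Decidable _≈_
  ≈? A B with included? (graph A) (graph B) | included? (graph B) (graph A)
  ... | inj₁ A⊆B              | inj₁ B⊆A              = yes (A⊆B , B⊆A)
  ... | inj₂ (_ , _ , a , ¬b) | _                     = no λ (A⊆B , _) → ¬b (A⊆B a)
  ... | inj₁ _                | inj₂ (_ , _ , b , ¬a) = no λ (_ , B⊆A) → ¬a (B⊆A b)

  interpolate : ∀ {A B} → A ≤ B × ¬ A ≈ B →
                ∃ λ C → (A ≤ C × ¬ A ≈ C) × C ≤ B × rank (graph C) ≡ suc (rank (graph A))
  interpolate {A} {B} (A≤B , A≉B) with included? (graph B) (graph A)
  ... | inj₁ B⊆A = ⊥-elim (A≉B (A≤B , B⊆A))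
  ... | inj₂ new = let C , A⊆C , C⊆B , rank-C = interpolation tight A B A≤B new in
        -- The bonds `A` and `C` differ because their ranks do.
        C , (A⊆C , λ (_ , C⊆A) → 1+n≢n
          (trans (sym rank-C) (rank-cong (graph C) (graph A) C⊆A A⊆C))) , C⊆B , rank-C
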